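{- For every well-formed context $\Gamma$ of MLTT° and all types $\Gamma \vdash A : \mathcal{U}$ and $\Gamma, x : A \vdash B : \mathcal{U}$, the judgement $\Gamma \vdash \Pi_{x:A} B \equiv \mathcal{U} : \mathcal{U}$ is not derivable.
   Context: MLTT° is the following type theory (dependent products and one universe with type-in-type). Terms are $M,N,A,B ::= x \mid \mathcal{U} \mid \Pi_{x:A}B \mid \lambda_{x:A}M \mid M\,N$, up to $\alpha$-equivalence, with capture-avoiding substitution $M[N/x]$. Contexts are finite lists of declarations $x:A$. The judgements $\vdash\Gamma$ (well-formed context), $\Gamma\vdash M:A$ (typing) and $\Gamma\vdash M\equiv N:A$ (definitional equality) are mutually inductively generated by the following rules. Contexts: the empty context is well-formed; if $\vdash\Gamma$ and $\Gamma\vdash A:\mathcal{U}$ then $\vdash\Gamma,x:A$ ($x$ fresh). Typing: (Var) if $\vdash\Gamma$ and $(x:A)\in\Gamma$ then $\Gamma\vdash x:A$. (Univ) if $\vdash\Gamma$ then $\Gamma\vdash\mathcal{U}:\mathcal{U}$. (Pi) if $\Gamma\vdash A:\mathcal{U}$ and $\Gamma,x:A\vdash B:\mathcal{U}$ then $\Gamma\vdash\Pi_{x:A}B:\mathcal{U}$. (Lam) if $\Gamma\vdash A:\mathcal{U}$ and $\Gamma,x:A\vdash M:B$ then $\Gamma\vdash\lambda_{x:A}M:\Pi_{x:A}B$. (App) if $\Gamma\vdash M:\Pi_{x:A}B$ and $\Gamma\vdash N:A$ then $\Gamma\vdash M\,N:B[N/x]$. (Conv) if $\Gamma\vdash M:A$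 and $\Gamma\vdash A\equiv B:\mathcal{U}$ then $\Gamma\vdash M:B$. Definitional equality: reflexivity on well-typed terms, symmetry, transitivity; conversion (if $\Gamma\vdash M\equiv N:A$ and $\Gamma\vdash A\equiv B:\mathcal{U}$ then $\Gamma\vdash M\equiv N:B$); congruence rules for $\Pi$, $\lambda$ and application; ($\beta$) if $\Gamma\vdash A:\mathcal{U}$, $\Gamma,x:A\vdash M:B$ and $\Gamma\vdash N:A$ then $\Gamma\vdash(\lambda_{x:A}M)\,N\equiv M[N/x]:B[N/x]$; ($\eta$) if $\Gamma\vdash M:\Pi_{x:A}B$, $\Gamma\vdash N:\Pi_{x:A}B$ and $\Gamma,x:A\vdash M\,x\equiv N\,x:B$ ($x$ fresh) then $\Gamma\vdash M\equiv N:\Pi_{x:A}B$. -}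

module Defs where

open import Data.Nat.Base using (ℕ; zero; suc)
open import Data.Fin.Base using (Fin; zero; suc)
open import Data.Fin.Substitution using (Lift; Sub; TermSubst)
open import Data.Vec.Base using (lookup)

-- Well-scoped de Bruijn terms: α-equivalent terms are equal, and every
-- freshness side condition holds by construction.  Π A B is Π_{x:A} B and
-- ƛ A M is λ_{x:A} M, where x is variable zero of B and of M.

infixl 9 _·_

data Term (n : ℕ) : Set where
  var : Fin n → Term n
  𝒰   : Term n
  Π   : Term n → Term (suc n) → Term n
  ƛ   : Term n → Term (suc n) → Term n
  _·_ : Term n → Term n → Term n

module TermApp {T : ℕ → Set} (l : Lift T Term) where

  open Lift l using (lift; _↑)

  infixl 8 _/_

  _/_ : ∀ {m n} → Term m → Sub T m n → Term n
  var x   / ρ = lift (lookup ρ x)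
  𝒰       / ρ = 𝒰
  Π A B   / ρ = Π (A / ρ) (B / (ρ ↑))
  ƛ A M   / ρ = ƛ (A / ρ) (M / (ρ ↑))
  (M · N) / ρ = (M / ρ) · (N / ρ)

termSubst : TermSubst Term
termSubst = record { var = var; app = TermApp._/_ }

open TermSubst termSubst public using (_/_; sub; weaken)

infix 10 _[_]

_[_] : ∀ {n} → Term (suc n) → Term n → Term n
M [ N ] = M / sub N

infixl 5 _▹_

data Ctx : ℕ → Set where
  ε   : Ctx zero
  _▹_ : ∀ {n} → Ctx n → Term n → Ctx (suc n)

infix 4 _∶_∈_

data _∶_∈_ : ∀ {n} → Fin n → Term n → Ctx n → Set where
  here  : ∀ {n} {Γ : Ctx n} {A} → zero ∶ weaken A ∈ Γ ▹ A
  there : ∀ {n} {Γ : Ctx n} {x A B} → x ∶ A ∈ Γ → suc x ∶ weaken A ∈ Γ ▹ B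

infix 4 ⊢_ _⊢_∶_ _⊢_≡_∶_

data ⊢_ : ∀ {n} → Ctx n → Set
data _⊢_∶_ {n : ℕ} (Γ : Ctx n) : Term n → Term n → Set
data _⊢_≡_∶_ {n : ℕ} (Γ : Ctx n) : Term n → Term n → Term n → Set

data ⊢_ where
  empty  : ⊢ ε
  extend : ∀ {n} {Γ : Ctx n} {A} → ⊢ Γ → Γ ⊢ A ∶ 𝒰 → ⊢ Γ ▹ A

data _⊢_∶_ {n} Γ where
  ty-var  : ∀ {x A} → ⊢ Γ → x ∶ A ∈ Γ → Γ ⊢ var x ∶ A
  ty-univ : ⊢ Γ → Γ ⊢ 𝒰 ∶ 𝒰
  ty-pi   : ∀ {A B} → Γ ⊢ A ∶ 𝒰 → Γ ▹ A ⊢ B ∶ 𝒰 → Γ ⊢ Π A B ∶ 𝒰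
  ty-lam  : ∀ {A B M} → Γ ⊢ A ∶ 𝒰 → Γ ▹ A ⊢ M ∶ B → Γ ⊢ ƛ A M ∶ Π A B
  ty-app  : ∀ {A B M N} → Γ ⊢ M ∶ Π A B → Γ ⊢ N ∶ A → Γ ⊢ M · N ∶ B [ N ]
  ty-conv : ∀ {A B M} → Γ ⊢ M ∶ A → Γ ⊢ A ≡ B ∶ 𝒰 → Γ ⊢ M ∶ B

data _⊢_≡_∶_ {n} Γ where
  eq-refl  : ∀ {A M} → Γ ⊢ M ∶ A → Γ ⊢ M ≡ M ∶ A
  eq-sym   : ∀ {A M N} → Γ ⊢ M ≡ N ∶ A → Γ ⊢ N ≡ M ∶ A
  eq-trans : ∀ {A M N P} → Γ ⊢ M ≡ N ∶ A → Γ ⊢ N ≡ P ∶ A → Γ ⊢ M ≡ P ∶ A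
  eq-conv  : ∀ {A B M N} → Γ ⊢ M ≡ N ∶ A → Γ ⊢ A ≡ B ∶ 𝒰 → Γ ⊢ M ≡ N ∶ B
  eq-pi    : ∀ {A A′ B B′} → Γ ⊢ A ≡ A′ ∶ 𝒰 → Γ ▹ A ⊢ B ≡ B′ ∶ 𝒰 →
             Γ ⊢ Π A B ≡ Π A′ B′ ∶ 𝒰
  eq-lam   : ∀ {A A′ B M M′} → Γ ⊢ A ≡ A′ ∶ 𝒰 → Γ ▹ A ⊢ M ≡ M′ ∶ B →
             Γ ⊢ ƛ A M ≡ ƛ A′ M′ ∶ Π A B
  eq-app   : ∀ {A B M M′ N N′} → Γ ⊢ M ≡ M′ ∶ Π A B → Γ ⊢ N ≡ N′ ∶ A →
             Γ ⊢ M · N ≡ M′ · N′ ∶ B [ N ]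
  eq-β     : ∀ {A B M N} → Γ ⊢ A ∶ 𝒰 → Γ ▹ A ⊢ M ∶ B → Γ ⊢ N ∶ A →
             Γ ⊢ ƛ A M · N ≡ M [ N ] ∶ B [ N ]
  eq-η     : ∀ {A B M N} → Γ ⊢ M ∶ Π A B → Γ ⊢ N ∶ Π A B →
             Γ ▹ A ⊢ weaken M · var zero ≡ weaken N · var zero ∶ B →
             Γ ⊢ M ≡ N ∶ Π A B

{-# OPTIONS --safe #-}
-- Erase domain annotations, send 𝒰 and every Π A B to two distinct inert
-- constants, and regard the result as an untyped λ-term.  The typed η rule
-- erases to an instance of untyped η, so definitionally equal terms erase to
-- βη-convertible ones.  Parallel βη-reduction has the diamond property,
-- hence the two constants are not convertible.
module Submission where

open import Defs
open import Data.Bool.Base using (Bool; true; false)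
open import Data.Fin.Base using (Fin; zero; suc)
open import Data.Fin.Properties using (suc-injective)
open import Data.Fin.Substitution using (Lift; Sub; module TermSubst; module VarSubst)
open import Data.Fin.Substitution.Lemmas using (module VarLemmas)
open import Data.Nat.Base using (ℕ; zero; suc; _+_; _≤_; _<_; s≤s)
open import Data.Nat.Induction using (<-wellFounded)
open import Data.Nat.Properties
  using (≤-refl; ≤-trans; <⇒≤; m≤m+n; m≤n+m; +-monoˡ-<; m≤n⇒m≤1+n)
open import Data.Product.Base using (∃; _×_; _,_)
open import Data.Sum.Base using (_⊎_; inj₁; inj₂)
open import Data.Vec.Base using (map; lookup)
open import Data.Vec.Properties using (lookup-map)
open import Function.Base using (id; _∘_)
open import Induction.WellFounded using (Acc; acc)
open import Relation.Binary.Construct.Closure.Equivalence as EqC using (EqClosure)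
open import Relation.Binary.Construct.Closure.ReflexiveTransitive using (Star; ε; _◅_; _◅◅_)
open import Relation.Binary.Construct.Closure.Symmetric using (fwd; bwd)
open import Relation.Binary.PropositionalEquality
  using (_≗_; refl; sym; trans; cong; cong₂; subst; subst₂; module ≡-Reasoning)
  renaming (_≡_ to _≐_)  -- Γ ⊢ M ≡ N ∶ A would otherwise also parse as Γ ⊢ (M ≡ N) ∶ A
open import Relation.Nullary.Negation.Core using (¬_)

private
  variable
    k l m n : ℕ

-- Untyped λ-terms with two constants.

data Λ (n : ℕ) : Set where
  var : Fin n → Λ n
  con : Bool → Λ n
  lam : Λ (suc n) → Λ n
  app : Λ n → Λ n → Λ n

ext : (Fin m → Fin n) → Fin (suc m) → Fin (suc n)
ext ρ zero    = zero
ext ρ (suc x) = suc (ρ x)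

rename : (Fin m → Fin n) → Λ m → Λ n
rename ρ (var x)   = var (ρ x)
rename ρ (con b)   = con b
rename ρ (lam M)   = lam (rename (ext ρ) M)
rename ρ (app M N) = app (rename ρ M) (rename ρ N)

exts : (Fin m → Λ n) → Fin (suc m) → Λ (suc n)
exts σ zero    = var zero
exts σ (suc x) = rename suc (σ x)

infixl 8 _⟪_⟫ _⟦_⟧

_⟪_⟫ : Λ m → (Fin m → Λ n) → Λ n
var x   ⟪ σ ⟫ = σ x
con b   ⟪ σ ⟫ = con b
lam M   ⟪ σ ⟫ = lam (M ⟪ exts σ ⟫)
app M N ⟪ σ ⟫ = app (M ⟪ σ ⟫) (N ⟪ σ ⟫)

infixr 5 _•_

_•_ : Λ n → (Fin m → Λ n) → Fin (suc m) → Λ n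
(N • σ) zero    = N
(N • σ) (suc x) = σ x

_⟦_⟧ : Λ (suc n) → Λ n → Λ n
M ⟦ N ⟧ = M ⟪ N • var ⟫

-- Substitution calculus

exts-cong : {σ τ : Fin m → Λ n} → σ ≗ τ → exts σ ≗ exts τ
exts-cong eq zero    = refl
exts-cong eq (suc x) = cong (rename suc) (eq x)

⟪⟫-cong : {σ τ : Fin m → Λ n} → σ ≗ τ → ∀ M → M ⟪ σ ⟫ ≐ M ⟪ τ ⟫
⟪⟫-cong eq (var x)   = eq x
⟪⟫-cong eq (con b)   = refl
⟪⟫-cong eq (lam M)   = cong lam (⟪⟫-cong (exts-cong eq) M)
⟪⟫-cong eq (app M N) = cong₂ app (⟪⟫-cong eq M) (⟪⟫-cong eq N)

exts-var : (ρ : Fin m → Fin n) → var ∘ ext ρ ≗ exts (var ∘ ρ)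
exts-var ρ zero    = refl
exts-var ρ (suc x) = refl

-- Treating renamings as substitutions by variables lets `rename-∘` follow from `rename-then-⟪⟫`
-- without an induction of its own.
rename-⟪⟫ : (ρ : Fin m → Fin n) → ∀ M → rename ρ M ≐ M ⟪ var ∘ ρ ⟫
rename-⟪⟫ ρ (var x)   = refl
rename-⟪⟫ ρ (con b)   = refl
rename-⟪⟫ ρ (lam M)   =
  cong lam (trans (rename-⟪⟫ (ext ρ) M) (⟪⟫-cong (exts-var ρ) M))
rename-⟪⟫ ρ (app M N) = cong₂ app (rename-⟪⟫ ρ M) (rename-⟪⟫ ρ N)

⟪var⟫ : (M : Λ n) → M ⟪ var ⟫ ≐ M
⟪var⟫ (var x)   = refl
⟪var⟫ (con b)   = refl
⟪var⟫ (lam M)   = cong lam (trans (⟪⟫-cong exts-id M) (⟪var⟫ M))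
  where
  exts-id : exts var ≗ var
  exts-id zero    = refl
  exts-id (suc x) = refl
⟪var⟫ (app M N) = cong₂ app (⟪var⟫ M) (⟪var⟫ N)

rename-then-⟪⟫ : (σ : Fin m → Λ n) (ρ : Fin l → Fin m) →
                 ∀ M → rename ρ M ⟪ σ ⟫ ≐ M ⟪ σ ∘ ρ ⟫
rename-then-⟪⟫ σ ρ (var x)   = refl
rename-then-⟪⟫ σ ρ (con b)   = refl
rename-then-⟪⟫ σ ρ (lam M)   =
  cong lam (trans (rename-then-⟪⟫ (exts σ) (ext ρ) M) (⟪⟫-cong exts-∘-ext M))
  where
  exts-∘-ext : exts σ ∘ ext ρ ≗ exts (σ ∘ ρ)
  exts-∘-ext zero    = refl
  exts-∘-ext (suc x) = refl
rename-then-⟪⟫ σ ρ (app M N) = cong₂ app (rename-then-⟪⟫ σ ρ M) (rename-then-⟪⟫ σ ρ N)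

rename-∘ : (ρ : Fin m → Fin n) (ρ′ : Fin l → Fin m) →
           ∀ M → rename ρ (rename ρ′ M) ≐ rename (ρ ∘ ρ′) M
rename-∘ ρ ρ′ M = begin
  rename ρ (rename ρ′ M)     ≡⟨ rename-⟪⟫ ρ (rename ρ′ M) ⟩
  rename ρ′ M ⟪ var ∘ ρ ⟫    ≡⟨ rename-then-⟪⟫ (var ∘ ρ) ρ′ M ⟩
  M ⟪ var ∘ ρ ∘ ρ′ ⟫         ≡⟨ rename-⟪⟫ (ρ ∘ ρ′) M ⟨
  rename (ρ ∘ ρ′) M          ∎
  where open ≡-Reasoning

rename-ext-suc : (ρ : Fin m → Fin n) → ∀ M →
                 rename (ext ρ) (rename suc M) ≐ rename suc (rename ρ M)
rename-ext-suc ρ M = trans (rename-∘ (ext ρ) suc M) (sym (rename-∘ suc ρ M))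

⟪⟫-then-rename : (ρ : Fin m → Fin n) (σ : Fin l → Λ m) →
                 ∀ M → rename ρ (M ⟪ σ ⟫) ≐ M ⟪ rename ρ ∘ σ ⟫
⟪⟫-then-rename ρ σ (var x)   = refl
⟪⟫-then-rename ρ σ (con b)   = refl
⟪⟫-then-rename ρ σ (lam M)   =
  cong lam (trans (⟪⟫-then-rename (ext ρ) (exts σ) M) (⟪⟫-cong rename-∘-exts M))
  where
  rename-∘-exts : rename (ext ρ) ∘ exts σ ≗ exts (rename ρ ∘ σ)
  rename-∘-exts zero    = refl
  rename-∘-exts (suc x) = rename-ext-suc ρ (σ x)
⟪⟫-then-rename ρ σ (app M N) = cong₂ app (⟪⟫-then-rename ρ σ M) (⟪⟫-then-rename ρ σ N)

exts-suc : (σ : Fin m → Λ n) → ∀ M → rename suc M ⟪ exts σ ⟫ ≐ rename suc (M ⟪ σ ⟫)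
exts-suc σ M = trans (rename-then-⟪⟫ (exts σ) suc M) (sym (⟪⟫-then-rename suc σ M))

⟪⟫-∘ : (τ : Fin m → Λ n) (σ : Fin l → Λ m) →
       ∀ M → M ⟪ σ ⟫ ⟪ τ ⟫ ≐ M ⟪ (λ x → σ x ⟪ τ ⟫) ⟫
⟪⟫-∘ τ σ (var x)   = refl
⟪⟫-∘ τ σ (con b)   = refl
⟪⟫-∘ τ σ (lam M)   =
  cong lam (trans (⟪⟫-∘ (exts τ) (exts σ) M) (⟪⟫-cong exts-∘ M))
  where
  exts-∘ : (λ x → exts σ x ⟪ exts τ ⟫) ≗ exts (λ x → σ x ⟪ τ ⟫)
  exts-∘ zero    = refl
  exts-∘ (suc x) = exts-suc τ (σ x)
⟪⟫-∘ τ σ (app M N) = cong₂ app (⟪⟫-∘ τ σ M) (⟪⟫-∘ τ σ N)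

⟦⟧-rename : (ρ : Fin m → Fin n) → ∀ M N →
            rename ρ (M ⟦ N ⟧) ≐ rename (ext ρ) M ⟦ rename ρ N ⟧
⟦⟧-rename ρ M N = begin
  rename ρ (M ⟦ N ⟧)                   ≡⟨ ⟪⟫-then-rename ρ (N • var) M ⟩
  M ⟪ rename ρ ∘ (N • var) ⟫           ≡⟨ ⟪⟫-cong (λ { zero → refl ; (suc x) → refl }) M ⟩
  M ⟪ (rename ρ N • var) ∘ ext ρ ⟫     ≡⟨ rename-then-⟪⟫ (rename ρ N • var) (ext ρ) M ⟨
  rename (ext ρ) M ⟦ rename ρ N ⟧      ∎
  where open ≡-Reasoning

suc-⟦⟧ : ∀ (M N : Λ n) → rename suc M ⟦ N ⟧ ≐ M
suc-⟦⟧ M N = trans (rename-then-⟪⟫ (N • var) suc M) (⟪var⟫ M)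

⟦⟧-⟪⟫ : (σ : Fin m → Λ n) → ∀ M N → M ⟦ N ⟧ ⟪ σ ⟫ ≐ M ⟪ exts σ ⟫ ⟦ N ⟪ σ ⟫ ⟧
⟦⟧-⟪⟫ σ M N = begin
  M ⟦ N ⟧ ⟪ σ ⟫
    ≡⟨ ⟪⟫-∘ σ (N • var) M ⟩
  M ⟪ (λ x → (N • var) x ⟪ σ ⟫) ⟫
    ≡⟨ ⟪⟫-cong (λ { zero → refl ; (suc x) → sym (suc-⟦⟧ (σ x) (N ⟪ σ ⟫)) }) M ⟩
  M ⟪ (λ x → exts σ x ⟦ N ⟪ σ ⟫ ⟧) ⟫
    ≡⟨ ⟪⟫-∘ (N ⟪ σ ⟫ • var) (exts σ) M ⟨
  M ⟪ exts σ ⟫ ⟦ N ⟪ σ ⟫ ⟧ ∎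
  where open ≡-Reasoning

-- The overlap of β with η: a weakened abstraction `lam M`, applied to the fresh variable, contracts
-- back to its own body.
ext-suc-⟦⟧ : (M : Λ (suc n)) → rename (ext suc) M ⟦ var zero ⟧ ≐ M
ext-suc-⟦⟧ M = begin
  rename (ext suc) M ⟦ var zero ⟧            ≡⟨ rename-then-⟪⟫ (var zero • var) (ext suc) M ⟩
  M ⟪ (var zero • var) ∘ ext suc ⟫           ≡⟨ ⟪⟫-cong (λ { zero → refl ; (suc x) → refl }) M ⟩
  M ⟪ var ⟫                                  ≡⟨ ⟪var⟫ M ⟩
  M                                          ∎
  where open ≡-Reasoning

-- Pullbacks of renamings

-- Only existence of `z` is demanded, hence "weak". Both cancelling a weakening and recognising one
-- through another renaming are instances of this property.
WeakPullback : (Fin l → Fin n) → (Fin m → Fin n) → (Fin k → Fin l) → (Fin k → Fin m) → Set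
WeakPullback f g p q = ∀ {x y} → f x ≐ g y → ∃ λ z → x ≐ p z × y ≐ q z

ext-pullback : {f : Fin l → Fin n} {g : Fin m → Fin n} {p : Fin k → Fin l} {q : Fin k → Fin m} →
               WeakPullback f g p q → WeakPullback (ext f) (ext g) (ext p) (ext q)
ext-pullback pb {zero}  {zero}  eq = zero , refl , refl
ext-pullback pb {suc x} {suc y} eq with pb (suc-injective eq)
... | z , x≡ , y≡ = suc z , cong suc x≡ , cong suc y≡

var-injective : {x y : Fin n} → Λ.var x ≐ var y → x ≐ y
var-injective refl = refl

con-injective : ∀ {b c} → Λ.con {n} b ≐ con c → b ≐ c
con-injective refl = refl

lam-injective : {M N : Λ (suc n)} → lam M ≐ lam N → M ≐ N
lam-injective refl = refl

app-injective : {M M′ N N′ : Λ n} → app M N ≐ app M′ N′ → M ≐ M′ × N ≐ N′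
app-injective refl = refl , refl

-- The property passes from variables to terms by simultaneous induction on `M` and `N`; binders are
-- handled by `ext-pullback`.
rename-pullback :
  {f : Fin l → Fin n} {g : Fin m → Fin n} {p : Fin k → Fin l} {q : Fin k → Fin m} →
  WeakPullback f g p q → ∀ M N → rename f M ≐ rename g N →
  ∃ λ P → M ≐ rename p P × N ≐ rename q P
rename-pullback pb (var x) (var y) eq with pb (var-injective eq)
... | z , refl , refl = var z , refl , refl
rename-pullback pb (con b) (con c) eq with con-injective eq
... | refl = con b , refl , refl
rename-pullback pb (lam M) (lam N) eq
  with rename-pullback (ext-pullback pb) M N (lam-injective eq)
... | P , refl , refl = lam P , refl , refl
rename-pullback pb (app M M′) (app N N′) eq with app-injective eq
... | eq₁ , eq₂ with rename-pullback pb M N eq₁ | rename-pullback pb M′ N′ eq₂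
... | P , refl , refl | P′ , refl , refl = app P P′ , refl , refl

rename-suc-injective : ∀ {M N : Λ n} → rename suc M ≐ rename suc N → M ≐ N
rename-suc-injective {M = M} {N} eq
  with rename-pullback {p = id} {q = id} (λ { refl → _ , refl , refl }) M N eq
... | P , refl , refl = refl

-- `ext ρ` sends only `zero` to positions outside the image of `suc`. So if variable zero is absent
-- after renaming, it was absent before, which is what reflecting an η-redex along `ρ` requires.
rename-ext≡rename-suc : (ρ : Fin m → Fin n) → ∀ {M N} → rename (ext ρ) M ≐ rename suc N →
                        ∃ λ P → M ≐ rename suc P × N ≐ rename ρ P
rename-ext≡rename-suc ρ {M} {N} = rename-pullback square M N
  where
  square : WeakPullback (ext ρ) suc suc ρ
  square {suc x} refl = x , refl , refl

-- Parallel βη-reduction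

infix 4 _⇛_ _≈_

-- In `η`, being a weakening says that the bound variable does not occur in `L`. It is stated as an
-- equation because an index mentioning the function `rename` would block unification when
-- derivations are matched.
data _⇛_ {n : ℕ} : Λ n → Λ n → Set where
  var : ∀ x → var x ⇛ var x
  con : ∀ b → con b ⇛ con b
  lam : ∀ {M M′} → M ⇛ M′ → lam M ⇛ lam M′
  app : ∀ {M M′ N N′} → M ⇛ M′ → N ⇛ N′ → app M N ⇛ app M′ N′
  β   : ∀ {M M′ N N′} → M ⇛ M′ → N ⇛ N′ → app (lam M) N ⇛ M′ ⟦ N′ ⟧
  η   : ∀ {L M M′} → L ≐ rename suc M → M ⇛ M′ → lam (app L (var zero)) ⇛ M′

⇛-refl : ∀ {M : Λ n} → M ⇛ M
⇛-refl {M = var x}   = var x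
⇛-refl {M = con b}   = con b
⇛-refl {M = lam M}   = lam ⇛-refl
⇛-refl {M = app M N} = app ⇛-refl ⇛-refl

⇛-rename : (ρ : Fin m → Fin n) → ∀ {M M′} → M ⇛ M′ → rename ρ M ⇛ rename ρ M′
⇛-rename ρ (var x)   = var (ρ x)
⇛-rename ρ (con b)   = con b
⇛-rename ρ (lam d)   = lam (⇛-rename (ext ρ) d)
⇛-rename ρ (app d e) = app (⇛-rename ρ d) (⇛-rename ρ e)
⇛-rename ρ (β {M′ = M′} {N′ = N′} d e) =
  subst (_ ⇛_) (sym (⟦⟧-rename ρ M′ N′)) (β (⇛-rename (ext ρ) d) (⇛-rename ρ e))
⇛-rename ρ (η {M = M} refl d) = η (rename-ext-suc ρ M) (⇛-rename ρ d)

⇛-⟪⟫ : {σ τ : Fin m → Λ n} → (∀ x → σ x ⇛ τ x) → ∀ {M M′} → M ⇛ M′ → M ⟪ σ ⟫ ⇛ M′ ⟪ τ ⟫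
⇛-⟪⟫ s (var x)   = s x
⇛-⟪⟫ s (con b)   = con b
⇛-⟪⟫ s (lam d)   = lam (⇛-⟪⟫ (λ { zero → var zero ; (suc x) → ⇛-rename suc (s x) }) d)
⇛-⟪⟫ s (app d e) = app (⇛-⟪⟫ s d) (⇛-⟪⟫ s e)
⇛-⟪⟫ {τ = τ} s (β {M′ = M′} {N′ = N′} d e) =
  subst (_ ⇛_) (sym (⟦⟧-⟪⟫ τ M′ N′))
    (β (⇛-⟪⟫ (λ { zero → var zero ; (suc x) → ⇛-rename suc (s x) }) d) (⇛-⟪⟫ s e))
⇛-⟪⟫ {σ = σ} s (η {M = M} refl d) = η (exts-suc σ M) (⇛-⟪⟫ s d)

⇛-⟦⟧ : ∀ {M M′} {N N′ : Λ n} → M ⇛ M′ → N ⇛ N′ → M ⟦ N ⟧ ⇛ M′ ⟦ N′ ⟧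
⇛-⟦⟧ d e = ⇛-⟪⟫ (λ { zero → e ; (suc x) → var x }) d

-- Every redex of a renamed term comes from a redex of the original, whether or not `ρ` is
-- injective. At `suc` this shows that reducts of weakenings are weakenings, so η-redexes survive
-- reduction of their function part.
⇛-rename⁻¹ : (ρ : Fin m → Fin n) → ∀ M {L L′} → L ⇛ L′ → L ≐ rename ρ M →
             ∃ λ M′ → M ⇛ M′ × L′ ≐ rename ρ M′
⇛-rename⁻¹ ρ (var x) (var _) refl = var x , var x , refl
⇛-rename⁻¹ ρ (con b) (con _) refl = con b , con b , refl
⇛-rename⁻¹ ρ (lam M) (lam d) refl with ⇛-rename⁻¹ (ext ρ) M d refl
... | M′ , d′ , refl = lam M′ , lam d′ , refl
⇛-rename⁻¹ ρ (lam (app M (var zero))) (η L≡ d) refl with rename-ext≡rename-suc ρ {M} L≡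
... | P , refl , refl with ⇛-rename⁻¹ ρ P d refl
... | P′ , d′ , refl = P′ , η refl d′ , refl
⇛-rename⁻¹ ρ (app M N) (app d e) refl
  with ⇛-rename⁻¹ ρ M d refl | ⇛-rename⁻¹ ρ N e refl
... | M′ , d′ , refl | N′ , e′ , refl = app M′ N′ , app d′ e′ , refl
⇛-rename⁻¹ ρ (app (lam M) N) (β d e) refl
  with ⇛-rename⁻¹ (ext ρ) M d refl | ⇛-rename⁻¹ ρ N e refl
... | M′ , d′ , refl | N′ , e′ , refl = M′ ⟦ N′ ⟧ , β d′ e′ , sym (⟦⟧-rename ρ M′ N′)

-- The two alternatives are a reduction inside `M`, which leaves an η-redex body, and the critical
-- pair where `M` is an abstraction and the body is itself a β-redex.
η-body⁻¹ : ∀ (M : Λ n) {R L} → R ⇛ L → R ≐ app (rename suc M) (var zero) →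
           (∃ λ M′ → M ⇛ M′ × L ≐ app (rename suc M′) (var zero)) ⊎
           (∃ λ K → M ≐ lam K × K ⇛ L)
η-body⁻¹ M (app d (var _)) refl with ⇛-rename⁻¹ suc M d refl
... | M′ , d′ , refl = inj₁ (M′ , d′ , refl)
η-body⁻¹ (lam K) (β d (var _)) refl with ⇛-rename⁻¹ (ext suc) K d refl
... | K′ , d′ , refl = inj₂ (K , refl , subst (K ⇛_) (sym (ext-suc-⟦⟧ K′)) d′)

-- The diamond property

-- The diamond property is proved by induction on size: the term contracted by `η` occurs in the
-- redex only up to weakening, and one case recurses on a newly built application. Renaming
-- preserves this measure.
size : Λ n → ℕ
size (var x)   = 1
size (con b)   = 1
size (lam M)   = suc (size M)
size (app M N) = suc (size M + size N)

size-rename : (ρ : Fin m → Fin n) → ∀ M → size (rename ρ M) ≐ size M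
size-rename ρ (var x)   = refl
size-rename ρ (con b)   = refl
size-rename ρ (lam M)   = cong suc (size-rename (ext ρ) M)
size-rename ρ (app M N) = cong₂ (λ a b → suc (a + b)) (size-rename ρ M) (size-rename ρ N)

size-η : ∀ (M : Λ n) → size M < size (lam (app (rename suc M) (var zero)))
size-η M = s≤s (m≤n⇒m≤1+n (subst (λ s → size M ≤ s + 1)
  (sym (size-rename suc M)) (m≤m+n (size M) 1)))

Joinable : Λ n → Λ n → Set
Joinable M N = ∃ λ P → M ⇛ P × N ⇛ P

Joinable-sym : {M N : Λ n} → Joinable M N → Joinable N M
Joinable-sym (P , d , e) = P , e , d

Diamond : Λ n → Set
Diamond M = ∀ {N P} → M ⇛ N → M ⇛ P → Joinable N P

-- The scope is quantified inside because the induction hypothesis is used both under binders and on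
-- terms strengthened by `η`.
DiamondBelow : ℕ → Set
DiamondBelow s = ∀ {n} (M : Λ n) → size M < s → Diamond M

-- If `L′` is still an η-redex body, `η` closes the square after joining the reducts of `M`.
-- Otherwise `M` is an abstraction and `lam L′` is already one of its reducts, so the hypothesis for
-- `M` applies directly.
join-lam-η : ∀ {L L′} {M M′ : Λ n} → DiamondBelow (size (lam (app L (var zero)))) →
             L ≐ rename suc M → app L (var zero) ⇛ L′ → M ⇛ M′ → Joinable (lam L′) M′
join-lam-η {M = M} rec refl d e with η-body⁻¹ M d refl
... | inj₁ (M″ , e′ , refl) with rec M (size-η M) e′ e
...   | P , f , g = P , η refl f , g
join-lam-η {M = M} rec refl d e | inj₂ (K , refl , d′) = rec M (size-η M) (lam d′) e

join-β-app : ∀ {M M′} {F N N′ N″ : Λ n} → DiamondBelow (size (app (lam M) N)) →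
             M ⇛ M′ → N ⇛ N′ → lam M ⇛ F → N ⇛ N″ → Joinable (M′ ⟦ N′ ⟧) (app F N″)
join-β-app {M = M} {N = N} rec d e (lam d′) e′
  with rec M (s≤s (m≤n⇒m≤1+n (m≤m+n (size M) (size N)))) d d′
     | rec N (s≤s (m≤n+m (size N) (suc (size M)))) e e′
... | P , f , f′ | Q , g , g′ = P ⟦ Q ⟧ , ⇛-⟦⟧ f g , β f′ g′
-- Here the function `lam (app (rename suc M) (var zero))` is contracted by `η` on one side and
-- applied by `β` on the other. If its body stays of η form, substituting `N′` undoes the weakening
-- and leaves `app M″ N′`.
join-β-app {N = N} {N′} rec d e (η {M = M} refl d′) e′ with η-body⁻¹ M d refl
... | inj₁ (M″ , d″ , refl)
      with rec M (s≤s (≤-trans (<⇒≤ (size-η M)) (m≤m+n _ (size N)))) d″ d′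
         | rec N (s≤s (m≤n+m (size N) _)) e e′
...   | P , f , f′ | Q , g , g′ =
        app P Q , subst (λ T → app T N′ ⇛ app P Q) (sym (suc-⟦⟧ M″ N′)) (app f g) , app f′ g′
-- Now `M` is `lam K`, and both results are reducts of the smaller term `app (lam K) N`: one by `β`,
-- the other by congruence.
join-β-app {N = N} rec d e (η {M = M} refl d′) e′ | inj₂ (K , refl , d″) =
  rec (app M N) (s≤s (+-monoˡ-< (size N) (size-η M))) (β d″ e) (app d′ e′)

diamond-step : (M : Λ n) → DiamondBelow (size M) → Diamond M
diamond-step (var x) rec (var _) (var _) = var x , var x , var x
diamond-step (con b) rec (con _) (con _) = con b , con b , con b
diamond-step (lam M) rec (lam d) (lam e) with rec M ≤-refl d e
... | P , f , g = lam P , lam f , lam g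
diamond-step (lam _) rec (lam d) (η eq e) = join-lam-η rec eq d e
diamond-step (lam _) rec (η eq d) (lam e) = Joinable-sym (join-lam-η rec eq e d)
-- Injectivity of weakening makes both η-steps contract to reducts of the same `M`.
diamond-step (lam _) rec (η {M = M} refl d) (η eq e) with rename-suc-injective eq
... | refl = rec M (size-η M) d e
diamond-step (app M N) rec (app d d′) (app e e′)
  with rec M (s≤s (m≤m+n (size M) (size N))) d e | rec N (s≤s (m≤n+m (size N) (size M))) d′ e′
... | P , f , g | Q , f′ , g′ = app P Q , app f f′ , app g g′
diamond-step (app _ _) rec (β d d′) (app e e′) = join-β-app rec d d′ e e′
diamond-step (app _ _) rec (app d d′) (β e e′) = Joinable-sym (join-β-app rec e e′ d d′)
diamond-step (app (lam M) N) rec (β d d′) (β e e′)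
  with rec M (s≤s (m≤n⇒m≤1+n (m≤m+n (size M) (size N)))) d e
     | rec N (s≤s (m≤n+m (size N) (suc (size M)))) d′ e′
... | P , f , g | Q , f′ , g′ = P ⟦ Q ⟧ , ⇛-⟦⟧ f f′ , ⇛-⟦⟧ g g′

diamond : (M : Λ n) → Diamond M
diamond M = go M (<-wellFounded (size M))
  where
  go : (M : Λ n) → Acc _<_ (size M) → Diamond M
  go M (acc rs) = diamond-step M (λ N lt → go N (rs lt))

-- Conversion to a constant.

strip : {M N P : Λ n} → M ⇛ N → Star _⇛_ M P → ∃ λ Q → Star _⇛_ N Q × P ⇛ Q
strip d ε = _ , ε , d
strip {M = M} d (e ◅ es) with diamond M d e
... | P , f , g with strip g es
... | Q , fs , h = Q , f ◅ fs , h

_≈_ : Λ n → Λ n → Set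
_≈_ = EqClosure _⇛_

-- Forward steps are prepended. A backward step is pushed across the remaining reduction by `strip`;
-- the resulting step out of `con b` can only end in `con b` again.
≈con⇒⇛* : {M : Λ n} {b : Bool} → M ≈ con b → Star _⇛_ M (con b)
≈con⇒⇛* ε = ε
≈con⇒⇛* (fwd d ◅ ds) = d ◅ ≈con⇒⇛* ds
≈con⇒⇛* (bwd d ◅ ds) with strip d (≈con⇒⇛* ds)
... | _ , es , con _ = es

con⇛* : {b c : Bool} → Star (_⇛_ {n}) (con b) (con c) → b ≐ c
con⇛* ε            = refl
con⇛* (con _ ◅ ds) = con⇛* ds

≈-app : {M M′ N N′ : Λ n} → M ≈ M′ → N ≈ N′ → app M N ≈ app M′ N′
≈-app {M′ = M′} {N} d e =
  EqC.gmap (λ L → app L N) (λ r → app r ⇛-refl) d ◅◅ EqC.gmap (app M′) (app ⇛-refl) e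

-- η-expand `M`, convert under the abstraction, and η-contract to `N`.
≈-η : {M N : Λ n} → app (rename suc M) (var zero) ≈ app (rename suc N) (var zero) → M ≈ N
≈-η d = bwd (η refl ⇛-refl) ◅ EqC.gmap lam lam d ◅◅ fwd (η refl ⇛-refl) ◅ ε

-- Erasure

-- Dropping the components of `Π` turns its congruence rule into reflexivity. Domains are dropped
-- because the raw term `ƛ A (weaken (ƛ B M) · var zero)` has β-reduct `ƛ A M` and η-reduct `ƛ B M`,
-- which need not be joinable.
⌊_⌋ : Term n → Λ n
⌊ var x ⌋ = var x
⌊ 𝒰 ⌋     = con false
⌊ Π A B ⌋ = con true
⌊ ƛ A M ⌋ = lam ⌊ M ⌋
⌊ M · N ⌋ = app ⌊ M ⌋ ⌊ N ⌋

module _ {T : ℕ → Set} (l : Lift T Term) where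
  open Lift l using (lift; _↑) renaming (var to varₜ; weaken to weakenₜ)
  open TermApp l using () renaming (_/_ to _/ₜ_)

  -- Being generic in the `Lift`, this covers weakening and substitution at once. The variable
  -- instance gives `erase-weaken`, which then supplies the weakening hypothesis of the term
  -- instance.
  erase-/ : (∀ {n} (x : Fin n) → ⌊ lift (varₜ x) ⌋ ≐ var x) →
            (∀ {n} (t : T n) → ⌊ lift (weakenₜ t) ⌋ ≐ rename suc ⌊ lift t ⌋) →
            ∀ (M : Term m) (ρ : Sub T m n) → ⌊ M /ₜ ρ ⌋ ≐ ⌊ M ⌋ ⟪ (λ x → ⌊ lift (lookup ρ x) ⌋) ⟫
  erase-/ lift-var lift-weaken = go
    where
    erase-↑ : (ρ : Sub T m n) →
              (λ x → ⌊ lift (lookup (ρ ↑) x) ⌋) ≗ exts (λ x → ⌊ lift (lookup ρ x) ⌋)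
    erase-↑ ρ zero    = lift-var zero
    erase-↑ ρ (suc x) =
      trans (cong (⌊_⌋ ∘ lift) (lookup-map x weakenₜ ρ)) (lift-weaken (lookup ρ x))

    go : ∀ (M : Term m) (ρ : Sub T m n) → ⌊ M /ₜ ρ ⌋ ≐ ⌊ M ⌋ ⟪ (λ x → ⌊ lift (lookup ρ x) ⌋) ⟫
    go (var x) ρ = refl
    go 𝒰       ρ = refl
    go (Π A B) ρ = refl
    go (ƛ A M) ρ = cong lam (trans (go M (ρ ↑)) (⟪⟫-cong (erase-↑ ρ) ⌊ M ⌋))
    go (M · N) ρ = cong₂ app (go M ρ) (go N ρ)

erase-weaken : (M : Term n) → ⌊ weaken M ⌋ ≐ rename suc ⌊ M ⌋
erase-weaken M = begin
  ⌊ weaken M ⌋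
    ≡⟨ erase-/ (TermSubst.varLift termSubst) (λ x → refl) (λ x → refl) M VarSubst.wk ⟩
  ⌊ M ⌋ ⟪ (λ x → var (lookup VarSubst.wk x)) ⟫
    ≡⟨ ⟪⟫-cong (λ x → cong var (VarLemmas.lookup-wk x)) ⌊ M ⌋ ⟩
  ⌊ M ⌋ ⟪ (λ x → var (suc x)) ⟫
    ≡⟨ rename-⟪⟫ suc ⌊ M ⌋ ⟨
  rename suc ⌊ M ⌋ ∎
  where open ≡-Reasoning

erase-lookup-id : (x : Fin n) → ⌊ lookup (TermSubst.id termSubst) x ⌋ ≐ var x
erase-lookup-id zero    = refl
erase-lookup-id (suc x) = begin
  ⌊ lookup (map weaken (TermSubst.id termSubst)) x ⌋
    ≡⟨ cong ⌊_⌋ (lookup-map x weaken (TermSubst.id termSubst)) ⟩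
  ⌊ weaken (lookup (TermSubst.id termSubst) x) ⌋
    ≡⟨ erase-weaken (lookup (TermSubst.id termSubst) x) ⟩
  rename suc ⌊ lookup (TermSubst.id termSubst) x ⌋
    ≡⟨ cong (rename suc) (erase-lookup-id x) ⟩
  var (suc x) ∎
  where open ≡-Reasoning

erase-[] : (M : Term (suc n)) (N : Term n) → ⌊ M [ N ] ⌋ ≐ ⌊ M ⌋ ⟦ ⌊ N ⌋ ⟧
erase-[] M N = trans
  (erase-/ (TermSubst.termLift termSubst) (λ x → refl) erase-weaken M (sub N))
  (⟪⟫-cong (λ { zero → refl ; (suc x) → erase-lookup-id x }) ⌊ M ⌋)

erase-≡ : ∀ {Γ : Ctx n} {M N A} → Γ ⊢ M ≡ N ∶ A → ⌊ M ⌋ ≈ ⌊ N ⌋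
erase-≡ (eq-refl _)    = ε
erase-≡ (eq-sym d)     = EqC.symmetric _⇛_ (erase-≡ d)
erase-≡ (eq-trans d e) = erase-≡ d ◅◅ erase-≡ e
erase-≡ (eq-conv d _)  = erase-≡ d
erase-≡ (eq-pi _ _)    = ε
erase-≡ (eq-lam _ d)   = EqC.gmap lam lam (erase-≡ d)
erase-≡ (eq-app d e)   = ≈-app (erase-≡ d) (erase-≡ e)
erase-≡ (eq-β {M = M} {N = N} _ _ _) =
  fwd (subst (app (lam ⌊ M ⌋) ⌊ N ⌋ ⇛_) (sym (erase-[] M N)) (β {M = ⌊ M ⌋} {N = ⌊ N ⌋} ⇛-refl ⇛-refl)) ◅ ε
erase-≡ (eq-η {M = M} {N = N} _ _ d) =
  ≈-η (subst₂ (λ L L′ → app L (var zero) ≈ app L′ (var zero))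
         (erase-weaken M) (erase-weaken N) (erase-≡ d))

theorem2p32 : ∀ {n : ℕ} {Γ : Ctx n} {A : Term n} {B : Term (suc n)} →
    ⊢ Γ → Γ ⊢ A ∶ 𝒰 → Γ ▹ A ⊢ B ∶ 𝒰 →
    ¬ (Γ ⊢ Π A B ≡ 𝒰 ∶ 𝒰)
-- The erased equation makes `con true` reduce to `con false`, forcing `true ≐ false`.
theorem2p32 _ _ _ d with () ← con⇛* (≈con⇒⇛* (erase-≡ d))
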